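{- Let $p$ be a prime, $r \geq 1$, $q \geq 0$, and $A = C_p^{(r)} \oplus I_q$. Then: (1) if $r = 1$ and $p \neq 2$, then $A \notin GR$; (2) if $r = 2$ and $p \in \{3,5\}$, then $A \in GR^*(3)$; (3) in all other cases, $A \in GR(2)$.
   Context: A $k$-colored graph $G=(V,E)$ consists of a finite set $V$ and a function $E$ from the 2-element subsets of $V$ to $\{0,\ldots,k-1\}$. An automorphism of $G$ is a permutation of $V$ preserving $E$; $Aut(G)$ is the automorphism group as a permutation group on $V$. Permutation groups are considered up to permutation isomorphism. $GR(k)$ is the class of permutation groups $(A,V)$ with $A=Aut(G)$ for some $k$-colored graph $G$ on $V$; $GR=\bigcup_k GR(k)$; $GR^*(k)=GR(k)\setminus GR(k-1)$. $C_p$ denotes the regular action of $\mathbb{Z}_p$ on $p$ points. $I_q$ denotes the trivial group acting on $q$ points; $A\oplus I_0=A$. For $(A,V)$, the parallel product $A^{(r)}$ is $A$ acting on $V\times\{1,\ldots,r\}$ by $a((v,i))=(a(v),i)$. For permutation groups with disjoint domains, the direct sum $A\oplus B$ is the group of pairs $(a,b)$ acting on the union, with $a$ acting on the domain of $A$ and $b$ on that of $B$. -}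

module Defs where

open import Level using (0ℓ)
open import Data.Nat using (ℕ; zero; suc; _+_)
open import Data.Nat.DivMod using (_mod_)
open import Data.Fin using (Fin; toℕ)
open import Data.Product using (Σ; ∃; _×_; _,_)
open import Data.Sum using (_⊎_; inj₁; inj₂)
open import Relation.Binary.PropositionalEquality using (_≡_; _≢_)
open import Relation.Nullary using (¬_)
open import Function.Bundles using (_↔_; Inverse; _⇔_)
open import Function.Definitions using (Bijective)

-- A permutation group on a carrier V, given as the predicate
-- "this map V → V is an element of the group".
PermGroup : Set → Set₁
PermGroup V = (V → V) → Set

-- A k-colored graph on W: a colour for each pair, symmetric; only
-- values on 2-element subsets {x,y} (x ≢ y) are ever consulted.
record ColGraph (k : ℕ) (W : Set) : Set where
  field
    E    : W → W → Fin k
    symm : ∀ x y → E x y ≡ E y x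
open ColGraph public

IsAut : ∀ {k W} → ColGraph k W → (W → W) → Set
IsAut G σ = Bijective _≡_ _≡_ σ × (∀ x y → x ≢ y → E G (σ x) (σ y) ≡ E G x y)

-- (A, V) ∈ GR(k): A is permutation isomorphic to Aut(G) for some k-colored
-- graph G on a finite set W (W = Fin m); φ : W ↔ V is the isomorphism of domains.
InGR : (k : ℕ) {V : Set} → PermGroup V → Set
InGR k {V} A =
  Σ ℕ λ m → Σ (ColGraph k (Fin m)) λ G → Σ (Fin m ↔ V) λ φ →
    ∀ (σ : Fin m → Fin m) →
      IsAut G σ ⇔ A (λ v → Inverse.to φ (σ (Inverse.from φ v)))

InGRany : {V : Set} → PermGroup V → Set
InGRany A = Σ ℕ λ k → InGR k A

InGRstar : (k : ℕ) {V : Set} → PermGroup V → Set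
InGRstar zero A = InGR zero A
InGRstar (suc k) A = InGR (suc k) A × ¬ InGR k A

addMod : ∀ {p} → Fin p → Fin p → Fin p
addMod {suc n} x a = (toℕ x + toℕ a) mod (suc n)

Dom : ℕ → ℕ → ℕ → Set
Dom p r q = (Fin r × Fin p) ⊎ Fin q

act : ∀ {p r q} → Fin p → Dom p r q → Dom p r q
act a (inj₁ (i , x)) = inj₁ (i , addMod x a)
act a (inj₂ j)       = inj₂ j

CpParI : (p r q : ℕ) → PermGroup (Dom p r q)
CpParI p r q f = ∃ λ (a : Fin p) → ∀ v → f v ≡ act a v

{-# OPTIONS --safe #-}

-- Fixed points are free: joining a new vertex to all others in a colour c that no vertex
-- has on all its edges adds a fixed point, and the next one may use a second colour. So for
-- the positive parts q = 0. Likewise, attaching a pendant vertex to each vertex of one copy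
-- of ℤ_p gives one more copy. What remains are small r: an edge for p = 2, graphs with
-- r = 3 (or three colours and r = 2) for p = 3, 5, and for p ≥ 7, r = 2, the p-cycle together with
-- the translates of the block {0, 1, 3}, which no reflection of ℤ_p maps to a translate.
-- Conversely, when r = 1, or when r = 2 and the colouring of ℤ_p by the differences between
-- the two copies is invariant under some reflection, reflecting each copy is a further
-- automorphism; for p = 3, 5 every 2-colouring of ℤ_p is invariant under some reflection.
module Submission where

open import Defs
open import Data.Nat using (ℕ; zero; suc; _+_; _*_; _∸_; _≤_; _<_; z≤n; s≤s; z<s; s<s)
import Data.Nat as ℕ
open import Data.Nat.DivMod using (_%_; _mod_; %-distribˡ-+; m<n⇒m%n≡m; n%n≡0; m%n<n)
open import Data.Nat.Primality using (Prime; prime?)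
open import Data.Nat.Properties
  using (+-comm; +-assoc; +-identityʳ; +-suc; m∸n+n≡m; m≤m+n; <⇒≤; ≤-trans; _<?_)
open import Data.Empty using (⊥; ⊥-elim)
open import Data.Fin using (Fin; zero; suc; toℕ; _≟_)
open import Data.Fin.Properties
  using (toℕ-injective; toℕ-fromℕ<; toℕ<n; suc-injective; 0≢1+n; <⇒notInjective; all?; any?; *↔×; +↔⊎)
open import Data.List using (List; []; _∷_; map; allFin; cartesianProductWith; _ʳ++_)
open import Data.List.Membership.Propositional using (_∈_)
open import Data.List.Membership.Propositional.Properties using (∈-cartesianProductWith⁺; ∈-allFin; ∈-map⁺)
open import Data.List.Relation.Unary.All as All using (All; []; _∷_)
open import Data.List.Relation.Unary.Any.Properties using (reverse⁺)
open import Data.Maybe using (Maybe; just; nothing) renaming (map to mapMaybe)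
open import Data.Maybe.Properties using (just-injective)
open import Data.Product using (Σ; ∃; ∃₂; _×_; _,_; proj₁; proj₂)
open import Data.Product.Properties using (≡-dec)
open import Data.Sum using (_⊎_; inj₁; inj₂; swap)
open import Data.Sum.Function.Propositional using (_⊎-↔_)
open import Data.Sum.Properties using (inj₁-injective)
open import Data.Vec using (Vec; []; _∷_; lookup; tabulate)
open import Data.Vec.Properties using (lookup∘tabulate)
open import Function using (_∘_; id; flip)
open import Function.Bundles using (_↔_; Inverse; mk⇔; mk↔ₛ′; Equivalence)
open import Function.Construct.Composition using (_↔-∘_)
open import Function.Construct.Identity using (↔-id)
open import Function.Construct.Symmetry using (↔-sym)
open import Relation.Binary using (DecidableEquality)
open import Relation.Binary.PropositionalEquality
open import Relation.Nullary using (¬_; Dec; yes; no; ¬?; _⊎-dec_; _×-dec_; _→-dec_)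
open import Relation.Nullary.Decidable
  using (True; False; toWitness; toWitnessFalse; from-yes; from-no; map′)
open import Relation.Unary using (Decidable)

-- Automorphisms

-- The content of `InGR` on the carrier itself, split into soundness and completeness of the family
-- `t`, so that the constructions never mention `Fin m`. Maps are compared pointwise, which avoids
-- function extensionality.
Realizes : {k : ℕ} {V I : Set} → ColGraph k V → (I → V → V) → Set
Realizes G t = (∀ a → IsAut G (t a)) × (∀ σ → IsAut G σ → ∃ λ a → ∀ v → σ v ≡ t a v)

pullback : {k : ℕ} {V W : Set} → (W → V) → ColGraph k V → ColGraph k W
pullback ι G = record { E = λ x y → E G (ι x) (ι y) ; symm = λ x y → symm G (ι x) (ι y) }

aut-injective : ∀ {k V} {G : ColGraph k V} {σ} → IsAut G σ → ∀ {x y} → σ x ≡ σ y → x ≡ y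
aut-injective ((inj , _) , _) = inj

aut-preimage : ∀ {k V} {G : ColGraph k V} {σ} → IsAut G σ → ∀ y → ∃ λ x → σ x ≡ y
aut-preimage ((_ , surj) , _) y = proj₁ (surj y) , proj₂ (surj y) refl

-- Serves both induced subgraphs and bijections. On a carrier not assumed finite, injectivity does
-- not give surjectivity of `σ`; `onto` supplies it.
aut-restrict : {k : ℕ} {V W : Set} {G : ColGraph k V} {H : ColGraph k W} {σ : W → W} {τ : V → V}
  (ι : W → V) → (∀ {x y} → ι x ≡ ι y → x ≡ y) →
  (∀ x y → E H x y ≡ E G (ι x) (ι y)) → (∀ w → ι (σ w) ≡ τ (ι w)) →
  (∀ w → ∃ λ w′ → τ (ι w′) ≡ ι w) → IsAut G τ → IsAut H σ
aut-restrict {G = G} {H} {σ} {τ} ι ι-inj ≈E comm onto ((inj , _) , pres) = (σ-inj , σ-surj) , σ-pres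
  where
  σ-inj : ∀ {x y} → σ x ≡ σ y → x ≡ y
  σ-inj {x} {y} eq = ι-inj (inj (trans (sym (comm x)) (trans (cong ι eq) (comm y))))
  σ-surj : ∀ w → ∃ λ w′ → ∀ {z} → z ≡ w′ → σ z ≡ w
  σ-surj w with onto w
  ... | w′ , eq = w′ , λ { refl → ι-inj (trans (comm w′) eq) }
  σ-pres : ∀ x y → x ≢ y → E H (σ x) (σ y) ≡ E H x y
  σ-pres x y x≢y = begin
    E H (σ x) (σ y)         ≡⟨ ≈E _ _ ⟩
    E G (ι (σ x)) (ι (σ y)) ≡⟨ cong₂ (E G) (comm x) (comm y) ⟩
    E G (τ (ι x)) (τ (ι y)) ≡⟨ pres _ _ (x≢y ∘ ι-inj) ⟩
    E G (ι x) (ι y)         ≡⟨ ≈E x y ⟨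
    E H x y                 ∎
    where open ≡-Reasoning

-- Comparing colours through `≈E`, rather than fixing `H` as a pullback, lets the lemma run along
-- `φ` and along its inverse.
aut-conjugate : {k : ℕ} {V W : Set} {G : ColGraph k V} {H : ColGraph k W} {σ : W → W} {τ : V → V}
  (φ : W ↔ V) → (∀ x y → E H x y ≡ E G (Inverse.to φ x) (Inverse.to φ y)) →
  (∀ w → Inverse.to φ (σ w) ≡ τ (Inverse.to φ w)) → IsAut G τ → IsAut H σ
aut-conjugate {G = G} {H = H} {τ = τ} φ ≈E comm autτ =
  aut-restrict {G = G} {H = H} to to-injective ≈E comm onto autτ
  where
  open Inverse φ
  to-injective : ∀ {x y} → to x ≡ to y → x ≡ y
  to-injective {x} {y} eq = trans (sym (strictlyInverseʳ x)) (trans (cong from eq) (strictlyInverseʳ y))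
  onto : ∀ w → ∃ λ w′ → τ (to w′) ≡ to w
  onto w with aut-preimage {G = G} autτ (to w)
  ... | v , eq = from v , trans (cong τ (strictlyInverseˡ v)) eq

realizes-along : {k : ℕ} {V W I : Set} {G : ColGraph k V} {t : I → V → V} {s : I → W → W} (φ : W ↔ V) →
  (∀ a w → Inverse.to φ (s a w) ≡ t a (Inverse.to φ w)) →
  Realizes G t → Realizes (pullback (Inverse.to φ) G) s
realizes-along {G = G} {t} {s} φ comm (sound , complete) = sound′ , complete′
  where
  open Inverse φ
  H = pullback to G
  sound′ : ∀ a → IsAut H (s a)
  sound′ a = aut-conjugate {G = G} {H = H} φ (λ _ _ → refl) (comm a) (sound a)
  complete′ : ∀ σ → IsAut H σ → ∃ λ a → ∀ v → σ v ≡ s a v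
  complete′ σ autσ
    with complete (to ∘ σ ∘ from)
           (aut-conjugate {G = H} {H = G} (↔-sym φ)
             (λ x y → sym (cong₂ (E G) (strictlyInverseˡ x) (strictlyInverseˡ y)))
             (λ v → strictlyInverseʳ (σ (from v))) autσ)
  ... | a , eq = a , λ w → begin
    σ w                       ≡⟨ cong σ (strictlyInverseʳ w) ⟨
    σ (from (to w))           ≡⟨ strictlyInverseʳ _ ⟨
    from (to (σ (from (to w)))) ≡⟨ cong from (eq (to w)) ⟩
    from (t a (to w))         ≡⟨ cong from (comm a w) ⟨
    from (to (s a w))         ≡⟨ strictlyInverseʳ _ ⟩
    s a w                     ∎
    where open ≡-Reasoning

-- `CpParI p r q` unfolds to `Orbit act`, so general facts about orbits apply to it without
-- conversion.
Orbit : {V I : Set} → (I → V → V) → PermGroup V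
Orbit t f = ∃ λ a → ∀ v → f v ≡ t a v

realizes⇒InGR : {k m : ℕ} {V I : Set} {G : ColGraph k V} {t : I → V → V} → Fin m ↔ V →
  Realizes G t → InGR k (Orbit t)
realizes⇒InGR {m = m} {G = G} {t} φ real@(sound , _) = m , pullback to G , φ , λ σ → mk⇔ (forth σ) (back σ)
  where
  open Inverse φ
  s : _ → Fin m → Fin m
  s a = from ∘ t a ∘ to
  real′ : Realizes (pullback to G) s
  real′ = realizes-along {G = G} {t = t} {s = s} φ (λ a w → strictlyInverseˡ _) real
  forth : ∀ σ → IsAut (pullback to G) σ → Orbit t (to ∘ σ ∘ from)
  forth σ autσ with proj₂ real′ σ autσ
  ... | a , eq = a , λ v → trans (cong to (eq (from v))) (trans (strictlyInverseˡ _) (cong (t a) (strictlyInverseˡ v)))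
  back : ∀ σ → Orbit t (to ∘ σ ∘ from) → IsAut (pullback to G) σ
  back σ (a , eq) = aut-conjugate {G = G} {H = pullback to G} φ (λ _ _ → refl)
    (λ w → trans (cong (to ∘ σ) (sym (strictlyInverseʳ w))) (eq (to w))) (sound a)

-- Used for the negative results: an arbitrary graph on `Fin m` is moved to the concrete domain,
-- where reflections can be written down.
InGR⇒realizes : {k : ℕ} {V I : Set} {t : I → V → V} → InGR k (Orbit t) →
  Σ (ColGraph k V) λ G → Realizes G t
InGR⇒realizes {V = V} {t = t} (m , G , φ , auts) = H , sound , complete
  where
  open Inverse φ
  H = pullback from G
  sound : ∀ a → IsAut H (t a)
  sound a = aut-conjugate {G = G} {H = H} (↔-sym φ) (λ _ _ → refl)
    (λ v → cong (from ∘ t a) (sym (strictlyInverseˡ v)))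
    (Equivalence.from (auts (from ∘ t a ∘ to))
      (a , λ v → trans (strictlyInverseˡ _) (cong (t a) (strictlyInverseˡ v))))
  complete : ∀ σ → IsAut H σ → Orbit t σ
  complete σ autσ
    with Equivalence.to (auts (from ∘ σ ∘ to))
           (aut-conjugate {G = H} {H = G} φ
             (λ x y → sym (cong₂ (E G) (strictlyInverseʳ x) (strictlyInverseʳ y)))
             (λ w → strictlyInverseˡ _) autσ)
  ... | a , eq = a , λ v → trans (cong σ (sym (strictlyInverseˡ v))) (trans (sym (strictlyInverseˡ _)) (eq v))

Adj : {k : ℕ} {V : Set} → ColGraph k V → Fin k → V → V → Set
Adj G c x y = x ≢ y × E G x y ≡ c

aut-adj : ∀ {k V} {G : ColGraph k V} {σ c} → IsAut G σ → ∀ {x y} → Adj G c x y → Adj G c (σ x) (σ y)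
aut-adj {G = G} aut@(_ , pres) (x≢y , eq) = x≢y ∘ aut-injective {G = G} aut , trans (pres _ _ x≢y) eq

-- Common core of both extension constructions: once the new vertices are recognised by a colour
-- condition, an automorphism preserves the old ones and is known there.
realizes-restrict : {k : ℕ} {V W I : Set} {G : ColGraph k V} {H : ColGraph k W} {t : I → W → W}
  (ι : W → V) → (∀ {x y} → ι x ≡ ι y → x ≡ y) → (∀ x y → E H x y ≡ E G (ι x) (ι y)) →
  Realizes H t → ∀ {τ} → IsAut G τ → (∀ w → ∃ λ w′ → τ (ι w) ≡ ι w′) → (∀ w → ∃ λ w′ → τ (ι w′) ≡ ι w) →
  ∃ λ a → ∀ w → τ (ι w) ≡ ι (t a w)
realizes-restrict {G = G} {H = H} ι ι-inj ≈E (_ , complete) aut into onto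
  with complete (proj₁ ∘ into)
         (aut-restrict {G = G} {H = H} ι ι-inj ≈E (λ w → sym (proj₂ (into w))) onto aut)
... | a , eq = a , λ w → trans (proj₂ (into w)) (cong ι (eq w))

-- Adding fixed points

coneE : {k : ℕ} {V : Set} → Fin k → ColGraph k V → Maybe V → Maybe V → Fin k
coneE c G (just x) (just y) = E G x y
coneE c G _        _        = c

cone : {k : ℕ} {V : Set} → Fin k → ColGraph k V → ColGraph k (Maybe V)
cone c G = record { E = coneE c G ; symm = λ where
  (just x) (just y) → symm G x y
  (just x) nothing  → refl
  nothing  (just y) → refl
  nothing  nothing  → refl }

Avoids : {k : ℕ} {V : Set} → Fin k → ColGraph k V → Set
Avoids c G = ∀ x → ∃ λ y → x ≢ y × E G x y ≢ c

-- The edges to the apex, all of colour `c`, are the witnesses; `v` makes sure that the apex has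
-- one.
cone-avoids : {k : ℕ} {V : Set} {G : ColGraph k V} {c d : Fin k} → V → c ≢ d → Avoids d (cone c G)
cone-avoids v c≢d (just x) = nothing , (λ ()) , c≢d
cone-avoids v c≢d nothing  = just v , (λ ()) , c≢d

-- By `Avoids`, the apex is the only vertex all of whose edges have colour `c`. Hence it is fixed,
-- and every automorphism restricts to `G`.
cone-realizes : {k : ℕ} {V I : Set} {G : ColGraph k V} {t : I → V → V} {c : Fin k} →
  Avoids c G → Realizes G t → Realizes (cone c G) (mapMaybe ∘ t)
cone-realizes {V = V} {G = G} {t} {c} avoids real@(sound , _) = sound′ , complete′
  where
  G⁺ = cone c G
  sound′ : ∀ a → IsAut G⁺ (mapMaybe (t a))
  sound′ a = (inj , surj) , pres
    where
    inj : ∀ {x y} → mapMaybe (t a) x ≡ mapMaybe (t a) y → x ≡ y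
    inj {just x}  {just y}  eq = cong just (aut-injective {G = G} (sound a) (just-injective eq))
    inj {nothing} {nothing} eq = refl
    surj : ∀ y → ∃ λ x → ∀ {z} → z ≡ x → mapMaybe (t a) z ≡ y
    surj nothing = nothing , λ { refl → refl }
    surj (just y) with aut-preimage {G = G} (sound a) y
    ... | x , eq = just x , λ { refl → cong just eq }
    pres : ∀ x y → x ≢ y → coneE c G (mapMaybe (t a) x) (mapMaybe (t a) y) ≡ coneE c G x y
    pres (just x) (just y) x≢y = proj₂ (sound a) x y (x≢y ∘ cong just)
    pres (just x) nothing  _   = refl
    pres nothing  (just y) _   = refl
    pres nothing  nothing  _   = refl
  complete′ : ∀ σ → IsAut G⁺ σ → ∃ λ a → ∀ v → σ v ≡ mapMaybe (t a) v
  complete′ σ aut@(_ , pres) = proj₁ restricted , λ where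
      (just x) → proj₂ restricted x
      nothing  → apex
    where
    coneE-apex : ∀ z → coneE c G nothing z ≡ c
    coneE-apex (just _) = refl
    coneE-apex nothing  = refl
    apex : σ nothing ≡ nothing
    apex with σ nothing in eq
    ... | nothing = refl
    ... | just x with avoids x
    ...   | y , x≢y , Exy≢c with aut-preimage {G = G⁺} aut (just y)
    ...     | z , eqz = ⊥-elim (Exy≢c (begin
                E G x y                      ≡⟨ cong₂ (coneE c G) eq eqz ⟨
                coneE c G (σ nothing) (σ z)  ≡⟨ pres nothing z nothing≢z ⟩
                coneE c G nothing z          ≡⟨ coneE-apex z ⟩
                c                            ∎))
      where
      open ≡-Reasoning
      nothing≢z : nothing ≢ z
      nothing≢z refl = x≢y (just-injective (trans (sym eq) eqz))
    into : ∀ x → ∃ λ y → σ (just x) ≡ just y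
    into x with σ (just x) in eq
    ... | just y = y , refl
    ... | nothing with aut-injective {G = G⁺} aut (trans eq (sym apex))
    ...   | ()
    onto : ∀ y → ∃ λ x → σ (just x) ≡ just y
    onto y with aut-preimage {G = G⁺} aut (just y)
    ... | just x  , eq = x , eq
    ... | nothing , eq with trans (sym apex) eq
    ...   | ()
    restricted : ∃ λ a → ∀ x → σ (just x) ≡ just (t a x)
    restricted = realizes-restrict {G = G⁺} {H = G} just just-injective (λ _ _ → refl) real aut into onto

-- Stands in for `V ⊎ Fin q` so that cones can be iterated by recursion; the outermost `nothing`
-- corresponds to index zero of `Fin q`.
Maybes : ℕ → Set → Set
Maybes zero    V = V
Maybes (suc q) V = Maybe (Maybes q V)

mapMaybes : {V : Set} → ∀ q → (V → V) → Maybes q V → Maybes q V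
mapMaybes zero    f = f
mapMaybes (suc q) f = mapMaybe (mapMaybes q f)

embed : {V : Set} → ∀ q → V → Maybes q V
embed zero    v = v
embed (suc q) v = just (embed q v)

-- The colours of successive apices alternate, so that none of them sees only the next colour.
alternate : {k : ℕ} → ℕ → Fin (suc (suc k))
alternate zero          = zero
alternate (suc zero)    = suc zero
alternate (suc (suc q)) = alternate q

alternate-≢ : ∀ {k} q → alternate {k} q ≢ alternate (suc q)
alternate-≢ zero          ()
alternate-≢ (suc zero)    ()
alternate-≢ (suc (suc q)) = alternate-≢ q

cones : {k : ℕ} {V : Set} → ∀ q → ColGraph (suc (suc k)) V → ColGraph (suc (suc k)) (Maybes q V)
cones zero    G = G
cones (suc q) G = cone (alternate q) (cones q G)

-- Avoidance travels along with realization because the next apex uses colour `alternate q`, which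
-- the graph built so far has to avoid.
cones-realizes : {k : ℕ} {V I : Set} {G : ColGraph (suc (suc k)) V} {t : I → V → V} → V →
  Avoids zero G → Realizes G t →
  ∀ q → Avoids (alternate q) (cones q G) × Realizes (cones q G) (mapMaybes q ∘ t)
cones-realizes v avoids real zero = avoids , real
cones-realizes {G = G} v avoids real (suc q) with cones-realizes {G = G} v avoids real q
... | avoids′ , real′ = cone-avoids {G = cones q G} (embed q v) (alternate-≢ q) , cone-realizes avoids′ real′

⊎⇒Maybes : {V : Set} → ∀ q → V ⊎ Fin q → Maybes q V
⊎⇒Maybes q       (inj₁ v)       = embed q v
⊎⇒Maybes (suc q) (inj₂ zero)    = nothing
⊎⇒Maybes (suc q) (inj₂ (suc j)) = just (⊎⇒Maybes q (inj₂ j))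

shift : {V : Set} {q : ℕ} → V ⊎ Fin q → V ⊎ Fin (suc q)
shift (inj₁ v) = inj₁ v
shift (inj₂ j) = inj₂ (suc j)

Maybes⇒⊎ : {V : Set} → ∀ q → Maybes q V → V ⊎ Fin q
Maybes⇒⊎ zero    v        = inj₁ v
Maybes⇒⊎ (suc q) nothing  = inj₂ zero
Maybes⇒⊎ (suc q) (just x) = shift (Maybes⇒⊎ q x)

⊎⇒Maybes-shift : {V : Set} → ∀ q (x : V ⊎ Fin q) → ⊎⇒Maybes (suc q) (shift x) ≡ just (⊎⇒Maybes q x)
⊎⇒Maybes-shift q (inj₁ v) = refl
⊎⇒Maybes-shift q (inj₂ j) = refl

⊎↔Maybes : {V : Set} → ∀ q → (V ⊎ Fin q) ↔ Maybes q V
⊎↔Maybes {V} q = mk↔ₛ′ (⊎⇒Maybes q) (Maybes⇒⊎ q) (invˡ q) (invʳ q)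
  where
  invˡ : ∀ q (x : Maybes q V) → ⊎⇒Maybes q (Maybes⇒⊎ q x) ≡ x
  invˡ zero    v        = refl
  invˡ (suc q) nothing  = refl
  invˡ (suc q) (just x) = trans (⊎⇒Maybes-shift q (Maybes⇒⊎ q x)) (cong just (invˡ q x))
  invʳ : ∀ q (x : V ⊎ Fin q) → Maybes⇒⊎ q (⊎⇒Maybes q x) ≡ x
  invʳ zero    (inj₁ v)       = refl
  invʳ (suc q) (inj₁ v)       = cong shift (invʳ q (inj₁ v))
  invʳ (suc q) (inj₂ zero)    = refl
  invʳ (suc q) (inj₂ (suc j)) = cong shift (invʳ q (inj₂ j))

diagonal : (p r : ℕ) → Fin p → Fin r × Fin p → Fin r × Fin p
diagonal p r a (i , x) = i , addMod x a

⊎⇒Maybes-act : ∀ {p r} q a (v : Dom p r q) →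
  ⊎⇒Maybes q (act a v) ≡ mapMaybes q (diagonal p r a) (⊎⇒Maybes q v)
⊎⇒Maybes-act zero    a (inj₁ v)       = refl
⊎⇒Maybes-act {p} {r} (suc q) a (inj₁ v) = cong just (⊎⇒Maybes-act {p} {r} q a (inj₁ v))
⊎⇒Maybes-act (suc q) a (inj₂ zero)    = refl
⊎⇒Maybes-act {p} {r} (suc q) a (inj₂ (suc j)) = cong just (⊎⇒Maybes-act {p} {r} q a (inj₂ j))

Dom-finite : ∀ p r q → ∃ λ m → Fin m ↔ Dom p r q
Dom-finite p r q = _ , ((*↔× ⊎-↔ ↔-id (Fin q)) ↔-∘ +↔⊎ {r * p} {q})

realizes-diagonal⇒InGR : ∀ {k p r} {G : ColGraph (suc (suc k)) (Fin r × Fin p)} → Fin r × Fin p →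
  Avoids zero G → Realizes G (diagonal p r) → ∀ q → InGR (suc (suc k)) (CpParI p r q)
realizes-diagonal⇒InGR {p = p} {r} {G} v avoids real q =
  realizes⇒InGR {G = pullback (⊎⇒Maybes q) (cones q G)} {t = act} (proj₂ (Dom-finite p r q))
    (realizes-along {G = cones q G} {t = mapMaybes q ∘ diagonal p r} {s = act} (⊎↔Maybes q) (⊎⇒Maybes-act q)
      (proj₂ (cones-realizes {G = G} {t = diagonal p r} v avoids real q)))

-- Residues modulo a positive number

residue : ∀ {n} → ℕ → Fin (suc n)
residue {n} m = m mod suc n

toℕ-residue : ∀ {n} m → toℕ (residue {n} m) ≡ m % suc n
toℕ-residue {n} m = toℕ-fromℕ< (m%n<n m (suc n))

residue-toℕ : ∀ {n} (x : Fin (suc n)) → residue (toℕ x) ≡ x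
residue-toℕ x = toℕ-injective (trans (toℕ-residue (toℕ x)) (m<n⇒m%n≡m (toℕ<n x)))

-- Reduction is a homomorphism; with `residue-toℕ` it transfers the laws of addition from ℕ to
-- residues.
addMod-residue : ∀ {n} m k → addMod (residue {n} m) (residue k) ≡ residue (m + k)
addMod-residue {n} m k = toℕ-injective (begin
  toℕ (addMod (residue {n} m) (residue k))              ≡⟨ toℕ-residue (toℕ (residue {n} m) + toℕ (residue {n} k)) ⟩
  (toℕ (residue {n} m) + toℕ (residue {n} k)) % suc n   ≡⟨ cong₂ (λ a b → (a + b) % suc n) (toℕ-residue m) (toℕ-residue k) ⟩
  (m % suc n + k % suc n) % suc n                       ≡⟨ %-distribˡ-+ m k (suc n) ⟨
  (m + k) % suc n                                       ≡⟨ toℕ-residue (m + k) ⟨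
  toℕ (residue {n} (m + k))                             ∎)
  where open ≡-Reasoning

addMod-comm : ∀ {n} (x y : Fin (suc n)) → addMod x y ≡ addMod y x
addMod-comm x y = cong residue (+-comm (toℕ x) (toℕ y))

addMod-assoc : ∀ {n} (x y z : Fin (suc n)) → addMod (addMod x y) z ≡ addMod x (addMod y z)
addMod-assoc x y z = begin
  addMod (addMod x y) z                     ≡⟨ cong (addMod (addMod x y)) (residue-toℕ z) ⟨
  addMod (addMod x y) (residue (toℕ z))     ≡⟨ addMod-residue (toℕ x + toℕ y) (toℕ z) ⟩
  residue (toℕ x + toℕ y + toℕ z)           ≡⟨ cong residue (+-assoc (toℕ x) (toℕ y) (toℕ z)) ⟩
  residue (toℕ x + (toℕ y + toℕ z))         ≡⟨ addMod-residue (toℕ x) (toℕ y + toℕ z) ⟨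
  addMod (residue (toℕ x)) (addMod y z)     ≡⟨ cong (λ w → addMod w (addMod y z)) (residue-toℕ x) ⟩
  addMod x (addMod y z)                     ∎
  where open ≡-Reasoning

addMod-identityˡ : ∀ {n} (x : Fin (suc n)) → addMod zero x ≡ x
addMod-identityˡ = residue-toℕ

addMod-identityʳ : ∀ {n} (x : Fin (suc n)) → addMod x zero ≡ x
addMod-identityʳ x = trans (addMod-comm x zero) (addMod-identityˡ x)

-- Taking the residue covers `x = zero`, where the difference is the modulus itself.
negMod : ∀ {n} → Fin (suc n) → Fin (suc n)
negMod {n} x = residue (suc n ∸ toℕ x)

addMod-inverseˡ : ∀ {n} (x : Fin (suc n)) → addMod (negMod x) x ≡ zero
addMod-inverseˡ {n} x = begin
  addMod (negMod x) x                    ≡⟨ cong (addMod (negMod x)) (residue-toℕ x) ⟨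
  addMod (negMod x) (residue (toℕ x))    ≡⟨ addMod-residue (suc n ∸ toℕ x) (toℕ x) ⟩
  residue (suc n ∸ toℕ x + toℕ x)        ≡⟨ cong residue (m∸n+n≡m (<⇒≤ (toℕ<n x))) ⟩
  residue (suc n)                        ≡⟨ toℕ-injective (trans (toℕ-residue (suc n)) (n%n≡0 (suc n))) ⟩
  zero                                   ∎
  where open ≡-Reasoning

addMod-inverseʳ : ∀ {n} (x : Fin (suc n)) → addMod x (negMod x) ≡ zero
addMod-inverseʳ x = trans (addMod-comm x (negMod x)) (addMod-inverseˡ x)

addMod-negʳ : ∀ {n} (x a : Fin (suc n)) → addMod (addMod x (negMod a)) a ≡ x
addMod-negʳ x a = trans (addMod-assoc x (negMod a) a)
  (trans (cong (addMod x) (addMod-inverseˡ a)) (addMod-identityʳ x))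

addMod-cancelʳ : ∀ {n} (a : Fin (suc n)) {x y} → addMod x a ≡ addMod y a → x ≡ y
addMod-cancelʳ a {x} {y} eq = trans (sym (strip x)) (trans (cong (λ w → addMod w (negMod a)) eq) (strip y))
  where
  strip : ∀ x → addMod (addMod x a) (negMod a) ≡ x
  strip x = trans (addMod-assoc x a (negMod a))
    (trans (cong (addMod x) (addMod-inverseʳ a)) (addMod-identityʳ x))

addMod-swapʳ : ∀ {n} (x a b : Fin (suc n)) → addMod (addMod x a) b ≡ addMod (addMod x b) a
addMod-swapʳ x a b = trans (addMod-assoc x a b)
  (trans (cong (addMod x) (addMod-comm a b)) (sym (addMod-assoc x b a)))

next : ∀ {n} → Fin (suc n) → Fin (suc n)
next x = addMod x (residue 1)

next-injective : ∀ {n} {x y : Fin (suc n)} → next x ≡ next y → x ≡ y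
next-injective = addMod-cancelʳ (residue 1)

next-addMod : ∀ {n} (x a : Fin (suc n)) → addMod (next x) a ≡ next (addMod x a)
next-addMod x a = addMod-swapʳ x (residue 1) a

prev : ∀ {n} → Fin (suc n) → Fin (suc n)
prev x = addMod x (negMod (residue 1))

next-prev : ∀ {n} (x : Fin (suc n)) → next (prev x) ≡ x
next-prev x = addMod-negʳ x (residue 1)

next-residue : ∀ {n} m → next (residue {n} m) ≡ residue (suc m)
next-residue m = trans (addMod-residue m 1) (cong residue (+-comm m 1))

-- One generates the cyclic group, so only translations commute with adding one; the proof is an
-- induction on the representative of `x`.
commutes-next⇒translation : ∀ {n} {s : Fin (suc n) → Fin (suc n)} →
  (∀ x → s (next x) ≡ next (s x)) → ∀ x → s x ≡ addMod x (s zero)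
commutes-next⇒translation {s = s} comm x =
  subst (λ w → s w ≡ addMod w (s zero)) (residue-toℕ x) (from-zero (toℕ x))
  where
  open ≡-Reasoning
  from-zero : ∀ m → s (residue m) ≡ addMod (residue m) (s zero)
  from-zero zero = sym (addMod-identityˡ (s zero))
  from-zero (suc m) = begin
    s (residue (suc m))                    ≡⟨ cong s (next-residue m) ⟨
    s (next (residue m))                   ≡⟨ comm (residue m) ⟩
    next (s (residue m))                   ≡⟨ cong next (from-zero m) ⟩
    next (addMod (residue m) (s zero))     ≡⟨ next-addMod (residue m) (s zero) ⟨
    addMod (next (residue m)) (s zero)     ≡⟨ cong (λ w → addMod w (s zero)) (next-residue m) ⟩
    addMod (residue (suc m)) (s zero)      ∎

-- At numerals this computes to nested `next`, so statements about `next (next x)` are instances of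
-- those about `nexts`.
nexts : ∀ {n} → ℕ → Fin (suc n) → Fin (suc n)
nexts zero    x = x
nexts (suc k) x = next (nexts k x)

nexts-addMod : ∀ {n} k (x : Fin (suc n)) → nexts k x ≡ addMod (residue k) x
nexts-addMod zero    x = sym (addMod-identityˡ x)
nexts-addMod (suc k) x = trans (cong next (nexts-addMod k x))
  (trans (sym (next-addMod (residue k) x)) (cong (λ w → addMod w x) (next-residue k)))

nexts-injective : ∀ {n} j k (x : Fin (suc n)) → j < suc n → k < suc n → nexts j x ≡ nexts k x → j ≡ k
nexts-injective {n} j k x j<n k<n eq = begin
  j                      ≡⟨ m<n⇒m%n≡m j<n ⟨
  j % suc n              ≡⟨ toℕ-residue j ⟨
  toℕ (residue {n} j)    ≡⟨ cong toℕ (addMod-cancelʳ x (trans (sym (nexts-addMod j x)) (trans eq (nexts-addMod k x)))) ⟩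
  toℕ (residue {n} k)    ≡⟨ toℕ-residue k ⟩
  k % suc n              ≡⟨ m<n⇒m%n≡m k<n ⟩
  k                      ∎
  where open ≡-Reasoning

next-≢ : ∀ {m} (x : Fin (suc (suc m))) → x ≢ next x
next-≢ x eq with nexts-injective 0 1 x z<s (s<s z<s) eq
... | ()

-- The diagonal action

Invariant : ∀ {k r p} → ColGraph k (Fin r × Fin p) → Set
Invariant {r = r} {p} G = ∀ a x y → E G (diagonal p r a x) (diagonal p r a y) ≡ E G x y

diagonal-injective : ∀ {n r} a {x y} → diagonal (suc n) r a x ≡ diagonal (suc n) r a y → x ≡ y
diagonal-injective a eq =
  cong₂ _,_ (cong proj₁ eq) (addMod-cancelʳ a (cong proj₂ eq))

invariant⇒sound : ∀ {k n r} (G : ColGraph k (Fin r × Fin (suc n))) → Invariant G → ∀ a → IsAut G (diagonal (suc n) r a)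
invariant⇒sound G invariant a =
  (diagonal-injective a , λ (i , y) → (i , addMod y (negMod a)) , λ { refl → cong (i ,_) (addMod-negʳ y a) }) ,
  λ x y _ → invariant a x y

-- Attaching pendant vertices

indicator : {P : Set} → Dec P → Fin 2
indicator (yes _) = suc zero
indicator (no _)  = zero

indicator-yes : {P : Set} (P? : Dec P) → P → indicator P? ≡ suc zero
indicator-yes (yes _) _ = refl
indicator-yes (no ¬p) p = ⊥-elim (¬p p)

indicator-one : {P : Set} (P? : Dec P) → indicator P? ≡ suc zero → P
indicator-one (yes p) _ = p

indicator-⇔ : {P Q : Set} (P? : Dec P) (Q? : Dec Q) → (P → Q) → (Q → P) → indicator P? ≡ indicator Q?
indicator-⇔ (yes p) Q? to _ = sym (indicator-yes Q? (to p))
indicator-⇔ (no ¬p) (yes q) _ from = ⊥-elim (¬p (from q))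
indicator-⇔ (no _)  (no _)  _ _ = refl

_~_within_ : {V : Set} → V → V → ColGraph 2 V → Set
x ~ y within G = Adj G (suc zero) x y

-- Degree at least two, counting edges of colour one.
Branching : {V : Set} → ColGraph 2 V → V → Set
Branching G x = ∃₂ λ y z → y ≢ z × (x ~ y within G) × (x ~ z within G)

-- The copy of ℤ_p with index zero is the one to which the next pendant vertices get attached.
Extensible : ∀ {r p} → ColGraph 2 (Fin (suc r) × Fin p) → Set
Extensible G = (∀ x → ∃ λ y → (zero , x) ~ y within G) × (∀ i x → Branching G (suc i , x))

extensible⇒avoids : ∀ {r p} {G : ColGraph 2 (Fin (suc r) × Fin p)} → Extensible G → Avoids zero G
extensible⇒avoids {G = G} (tip , branch) = λ where
    (zero , x)  → proj₁ (tip x) , nonzero (proj₂ (tip x))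
    (suc i , x) → let (y , _ , _ , adj , _) = branch i x in y , nonzero adj
  where
  nonzero : ∀ {x y} → x ~ y within G → x ≢ y × E G x y ≢ zero
  nonzero (x≢y , eq) = x≢y , λ eq₀ → 0≢1+n (trans (sym eq₀) eq)

raise : ∀ {r p} → Fin r × Fin p → Fin (suc r) × Fin p
raise (i , x) = suc i , x

raise-injective : ∀ {r p} {x y : Fin r × Fin p} → raise x ≡ raise y → x ≡ y
raise-injective eq = cong₂ _,_ (suc-injective (cong proj₁ eq)) (cong proj₂ eq)

-- The new copy takes index zero and the old ones move up, so the pendant vertices form the tip to
-- which a further copy can be attached.
pendantE : ∀ {r p} → ColGraph 2 (Fin (suc r) × Fin p) → (u v : Fin (suc (suc r)) × Fin p) → Fin 2
pendantE G (suc i , x)        (suc j , y)        = E G (i , x) (j , y)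
pendantE G (zero , x)         (suc zero , y)     = indicator (x ≟ y)
pendantE G (suc zero , x)     (zero , y)         = indicator (y ≟ x)
pendantE G (zero , _)         (zero , _)         = zero
pendantE G (zero , _)         (suc (suc _) , _)  = zero
pendantE G (suc (suc _) , _)  (zero , _)         = zero

pendant : ∀ {r p} → ColGraph 2 (Fin (suc r) × Fin p) → ColGraph 2 (Fin (suc (suc r)) × Fin p)
pendant G = record { E = pendantE G ; symm = λ where
  (suc i , x)        (suc j , y)        → symm G (i , x) (j , y)
  (zero , x)         (suc zero , y)     → refl
  (suc zero , x)     (zero , y)         → refl
  (zero , _)         (zero , _)         → refl
  (zero , _)         (suc (suc _) , _)  → refl
  (suc (suc _) , _)  (zero , _)         → refl }

module _ {r p : ℕ} {G : ColGraph 2 (Fin (suc r) × Fin p)} where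
  raise-adj : ∀ {x y} → x ~ y within G → raise x ~ raise y within pendant G
  raise-adj (x≢y , eq) = x≢y ∘ raise-injective , eq

  pendant-edge : ∀ x → (zero , x) ~ (suc zero , x) within pendant G
  pendant-edge x = (λ ()) , indicator-yes (x ≟ x) refl

  pendant-adj : ∀ {x v} → (zero , x) ~ v within pendant G → v ≡ (suc zero , x)
  pendant-adj {x} {suc zero , y} (_ , eq) = cong (suc zero ,_) (sym (indicator-one (x ≟ y) eq))

  pendant-not-branching : ∀ {x} → ¬ Branching (pendant G) (zero , x)
  pendant-not-branching (_ , _ , y≢z , x~y , x~z) = y≢z (trans (pendant-adj x~y) (sym (pendant-adj x~z)))

  -- A former tip vertex is only known to have one old neighbour; its pendant vertex is the second.
  raise-branching : Extensible G → ∀ v → Branching (pendant G) (raise v)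
  raise-branching (tip , _) (zero , x) with tip x
  ... | y , x~y = raise y , (zero , x) , (λ ()) , raise-adj x~y , (λ ()) , indicator-yes (x ≟ x) refl
  raise-branching (_ , branch) (suc i , x) with branch i x
  ... | y , z , y≢z , x~y , x~z = raise y , raise z , y≢z ∘ raise-injective , raise-adj x~y , raise-adj x~z

  pendant-extensible : Extensible G → Extensible (pendant G)
  pendant-extensible ext = (λ x → (suc zero , x) , pendant-edge x) , λ i x → raise-branching ext (i , x)

aut-branching : ∀ {V} {G : ColGraph 2 V} {σ v} → IsAut G σ → Branching G v → Branching G (σ v)
aut-branching {G = G} {σ} aut (y , z , y≢z , v~y , v~z) =
  σ y , σ z , y≢z ∘ aut-injective {G = G} aut , aut-adj {G = G} aut v~y , aut-adj {G = G} aut v~z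

aut-branching⁻ : ∀ {V} {G : ColGraph 2 V} {σ v} → IsAut G σ → Branching G (σ v) → Branching G v
aut-branching⁻ {G = G} {σ} {v} aut@(_ , pres) (y , z , y≢z , v~y , v~z)
  with aut-preimage {G = G} aut y | aut-preimage {G = G} aut z
... | y′ , refl | z′ , refl = y′ , z′ , y≢z ∘ cong σ , reflect v~y , reflect v~z
  where
  reflect : ∀ {y} → σ v ~ σ y within G → v ~ y within G
  reflect (≢ , eq) = ≢ ∘ cong σ , trans (sym (pres _ _ (≢ ∘ cong σ))) eq

pendant-invariant : ∀ {r n} {G : ColGraph 2 (Fin (suc r) × Fin (suc n))} → Invariant G → Invariant (pendant G)
pendant-invariant inv a (suc i , x)        (suc j , y)        = inv a (i , x) (j , y)
pendant-invariant inv a (zero , x)         (suc zero , y)     = indicator-⇔ _ _ (addMod-cancelʳ a) (cong (λ w → addMod w a))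
pendant-invariant inv a (suc zero , x)     (zero , y)         = indicator-⇔ _ _ (addMod-cancelʳ a) (cong (λ w → addMod w a))
pendant-invariant inv a (zero , _)         (zero , _)         = refl
pendant-invariant inv a (zero , _)         (suc (suc _) , _)  = refl
pendant-invariant inv a (suc (suc _) , _)  (zero , _)         = refl

-- Exactly the new vertices have at most one neighbour, so automorphisms restrict to the old graph.
pendant-complete : ∀ {r p} {G : ColGraph 2 (Fin (suc r) × Fin p)} → Extensible G →
  Realizes G (diagonal p (suc r)) → ∀ σ → IsAut (pendant G) σ →
  ∃ λ a → ∀ v → σ v ≡ diagonal p (suc (suc r)) a v
pendant-complete {r} {p} {G} ext real σ aut = a , on-all
  where
  G⁺ = pendant G
  old : ∀ v → Branching G⁺ v → ∃ λ w → v ≡ raise w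
  old (zero , x)  br = ⊥-elim (pendant-not-branching {G = G} br)
  old (suc i , x) br = (i , x) , refl
  into : ∀ w → ∃ λ w′ → σ (raise w) ≡ raise w′
  into w = old (σ (raise w)) (aut-branching {G = G⁺} aut (raise-branching ext w))
  onto : ∀ w → ∃ λ w′ → σ (raise w′) ≡ raise w
  onto w with aut-preimage {G = G⁺} aut (raise w)
  ... | v , eq with old v (aut-branching⁻ {G = G⁺} aut (subst (Branching G⁺) (sym eq) (raise-branching ext w)))
  ...   | w′ , refl = w′ , eq
  restricted : ∃ λ a → ∀ w → σ (raise w) ≡ raise (diagonal p (suc r) a w)
  restricted = realizes-restrict {G = G⁺} {H = G} raise raise-injective (λ _ _ → refl) real aut into onto
  a = proj₁ restricted
  on-tip : ∀ x v → σ (zero , x) ≡ v → v ≡ (zero , addMod x a)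
  on-tip x (suc i , y) eq =
    ⊥-elim (pendant-not-branching {G = G} (aut-branching⁻ {G = G⁺} aut
      (subst (Branching G⁺) (sym eq) (raise-branching ext (i , y)))))
  -- The pendant edge at `x` maps to a pendant edge whose old end is already known to be
  -- `(suc zero , addMod x a)`; the two ends of a pendant edge share their residue.
  on-tip x (zero , y) eq =
    cong (zero ,_) (sym (cong proj₂ (pendant-adj {G = G} (subst₂ (λ u v → u ~ v within G⁺) eq
      (proj₂ restricted (zero , x)) (aut-adj {G = G⁺} aut (pendant-edge {G = G} x))))))
  on-all : ∀ v → σ v ≡ diagonal p (suc (suc r)) a v
  on-all (zero , x)  = on-tip x _ refl
  on-all (suc i , x) = proj₂ restricted (i , x)

-- The index counts copies of ℤ_p beyond the first: Seed p r concerns r + 1 copies.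
record Seed (p r : ℕ) : Set where
  field
    graph      : ColGraph 2 (Fin (suc r) × Fin p)
    invariant  : Invariant graph
    extensible : Extensible graph
    complete   : ∀ σ → IsAut graph σ → ∃ λ a → ∀ v → σ v ≡ diagonal p (suc r) a v

seed-suc : ∀ {n r} → Seed (suc n) r → Seed (suc n) (suc r)
seed-suc s = record
  { graph = pendant graph
  ; invariant = pendant-invariant {G = graph} invariant
  ; extensible = pendant-extensible {G = graph} extensible
  ; complete = pendant-complete {G = graph} extensible (invariant⇒sound graph invariant , complete) }
  where open Seed s

seed-+ : ∀ {n r} d → Seed (suc n) r → Seed (suc n) (r + d)
seed-+ {n} {r} zero    s = subst (Seed (suc n)) (sym (+-identityʳ r)) s
seed-+ {n} {r} (suc d) s = subst (Seed (suc n)) (sym (+-suc r d)) (seed-suc (seed-+ d s))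

seed⇒InGR : ∀ {n r} → Seed (suc n) r → ∀ q → InGR 2 (CpParI (suc n) (suc r) q)
seed⇒InGR s = realizes-diagonal⇒InGR {G = graph} (zero , zero)
  (extensible⇒avoids {G = graph} extensible) (invariant⇒sound graph invariant , complete)
  where open Seed s

-- A bicirculant graph for p ≥ 7

Cyclic : ∀ {n} → Fin (suc n) → Fin (suc n) → Set
Cyclic x y = next x ≡ y ⊎ next y ≡ x

-- The block of y is y + {0, 1, 3}; for p ≥ 7 a reflection of ℤ_p never maps blocks to blocks.
Incident : ∀ {n} → Fin (suc n) → Fin (suc n) → Set
Incident x y = x ≡ y ⊎ x ≡ next y ⊎ x ≡ next (next (next y))

cyclic? : ∀ {n} (x y : Fin (suc n)) → Dec (Cyclic x y)
cyclic? x y = next x ≟ y ⊎-dec next y ≟ x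

incident? : ∀ {n} (x y : Fin (suc n)) → Dec (Incident x y)
incident? x y = x ≟ y ⊎-dec x ≟ next y ⊎-dec x ≟ next (next (next y))

-- Copy zero holds the points, joined in a cycle; copy one holds the blocks, pairwise not joined.
-- For `p ≥ 7` points have degree five and blocks degree three.
incidenceE : ∀ {n} → Fin 2 × Fin (suc n) → Fin 2 × Fin (suc n) → Fin 2
incidenceE (zero , x)     (zero , y)     = indicator (cyclic? x y)
incidenceE (zero , x)     (suc zero , y) = indicator (incident? x y)
incidenceE (suc zero , x) (zero , y)     = indicator (incident? y x)
incidenceE (suc zero , x) (suc zero , y) = zero

incidence : ∀ {n} → ColGraph 2 (Fin 2 × Fin (suc n))
incidence = record { E = incidenceE ; symm = λ where
  (zero , x)     (zero , y)     → indicator-⇔ (cyclic? x y) (cyclic? y x) swap swap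
  (zero , x)     (suc zero , y) → refl
  (suc zero , x) (zero , y)     → refl
  (suc zero , x) (suc zero , y) → refl }

incident-invariant : ∀ {n} (a x y : Fin (suc n)) →
  indicator (incident? (addMod x a) (addMod y a)) ≡ indicator (incident? x y)
incident-invariant a x y = indicator-⇔ _ _
    (λ { (inj₁ eq) → inj₁ (addMod-cancelʳ a eq)
       ; (inj₂ (inj₁ eq)) → inj₂ (inj₁ (addMod-cancelʳ a (trans eq (sym next¹))))
       ; (inj₂ (inj₂ eq)) → inj₂ (inj₂ (addMod-cancelʳ a (trans eq (sym next³)))) })
    (λ { (inj₁ refl) → inj₁ refl ; (inj₂ (inj₁ refl)) → inj₂ (inj₁ next¹) ; (inj₂ (inj₂ refl)) → inj₂ (inj₂ next³) })
  where
  next¹ : addMod (next y) a ≡ next (addMod y a)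
  next¹ = next-addMod y a
  next³ : addMod (next (next (next y))) a ≡ next (next (next (addMod y a)))
  next³ = trans (next-addMod (next (next y)) a) (cong next (trans (next-addMod (next y) a) (cong next next¹)))

incidence-invariant : ∀ {n} → Invariant (incidence {n})
incidence-invariant a (zero , x) (zero , y) = indicator-⇔ _ _
    (λ { (inj₁ eq) → inj₁ (down x y eq) ; (inj₂ eq) → inj₂ (down y x eq) })
    (λ { (inj₁ refl) → inj₁ (sym (next-addMod x a)) ; (inj₂ refl) → inj₂ (sym (next-addMod y a)) })
  where
  down : ∀ x y → next (addMod x a) ≡ addMod y a → next x ≡ y
  down x y eq = addMod-cancelʳ a (trans (next-addMod x a) eq)
incidence-invariant a (zero , x) (suc zero , y) = incident-invariant a x y
incidence-invariant a (suc zero , x) (zero , y) = incident-invariant a y x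
incidence-invariant a (suc zero , x) (suc zero , y) = refl

module _ (n : ℕ) where
  private
    p : ℕ
    p = 7 + n
    P : Set
    P = Fin p
    G : ColGraph 2 (Fin 2 × P)
    G = incidence

  -- Here `p ≥ 7` enters: at most six steps are less than a full turn. The bounds are decided by
  -- evaluation, so each use names only two numerals.
  nexts-≢ : ∀ j k (x : P) {j<7 : True (j <? 7)} {k<7 : True (k <? 7)} {j≢k : False (j ℕ.≟ k)} →
    nexts j x ≢ nexts k x
  nexts-≢ j k x {j<7} {k<7} {j≢k} =
    toWitnessFalse j≢k ∘ nexts-injective j k x (bound j<7) (bound k<7)
    where
    bound : ∀ {m} → True (m <? 7) → m < p
    bound m<7 = ≤-trans (toWitness m<7) (m≤m+n 7 n)

  cyclic-edge : {x y : P} → Cyclic x y → (zero , x) ~ (zero , y) within G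
  cyclic-edge {x} {y} c = (λ { refl → irrefl c }) , indicator-yes (cyclic? x y) c
    where
    irrefl : ∀ {x : P} → ¬ Cyclic x x
    irrefl {x} (inj₁ eq) = nexts-≢ 1 0 x eq
    irrefl {x} (inj₂ eq) = nexts-≢ 1 0 x eq

  incident-edge : {x y : P} → Incident x y → (zero , x) ~ (suc zero , y) within G
  incident-edge {x} {y} i = (λ ()) , indicator-yes (incident? x y) i

  incident-edge′ : {x y : P} → Incident x y → (suc zero , y) ~ (zero , x) within G
  incident-edge′ {x} {y} i = (λ ()) , indicator-yes (incident? x y) i

  incidence-extensible : Extensible G
  incidence-extensible = (λ x → (suc zero , x) , incident-edge (inj₁ refl)) ,
    λ { zero y → (zero , y) , (zero , next y) , (nexts-≢ 0 1 y ∘ cong proj₂) ,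
                 incident-edge′ (inj₁ refl) , incident-edge′ (inj₂ (inj₁ refl)) }

  -- Degree at least four, which tells points from blocks and is visibly preserved and reflected by
  -- automorphisms.
  FourNeighbours : Fin 2 × P → Set
  FourNeighbours v = Σ (Fin 4 → Fin 2 × P) λ g → (∀ {i j} → g i ≡ g j → i ≡ j) × (∀ i → v ~ g i within G)

  cycle-four : ∀ x → FourNeighbours (zero , x)
  cycle-four x = g , inj , adj
    where
    g : Fin 4 → Fin 2 × P
    g zero                   = zero , next x
    g (suc zero)             = zero , prev x
    -- `x` is the first point of block `x` and the second of block `prev x`.
    g (suc (suc zero))       = suc zero , x
    g (suc (suc (suc zero))) = suc zero , prev x
    next≢prev : next x ≢ prev x
    next≢prev eq = nexts-≢ 2 0 x (trans (cong next eq) (next-prev x))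
    self≢prev : x ≢ prev x
    self≢prev eq = nexts-≢ 1 0 x (trans (cong next eq) (next-prev x))
    inj : ∀ {i j} → g i ≡ g j → i ≡ j
    inj {zero} {zero} _ = refl
    inj {zero} {suc zero} eq = ⊥-elim (next≢prev (cong proj₂ eq))
    inj {zero} {suc (suc zero)} ()
    inj {zero} {suc (suc (suc zero))} ()
    inj {suc zero} {zero} eq = ⊥-elim (next≢prev (sym (cong proj₂ eq)))
    inj {suc zero} {suc zero} _ = refl
    inj {suc zero} {suc (suc zero)} ()
    inj {suc zero} {suc (suc (suc zero))} ()
    inj {suc (suc zero)} {zero} ()
    inj {suc (suc zero)} {suc zero} ()
    inj {suc (suc zero)} {suc (suc zero)} _ = refl
    inj {suc (suc zero)} {suc (suc (suc zero))} eq = ⊥-elim (self≢prev (cong proj₂ eq))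
    inj {suc (suc (suc zero))} {zero} ()
    inj {suc (suc (suc zero))} {suc zero} ()
    inj {suc (suc (suc zero))} {suc (suc zero)} eq = ⊥-elim (self≢prev (sym (cong proj₂ eq)))
    inj {suc (suc (suc zero))} {suc (suc (suc zero))} _ = refl
    adj : ∀ i → (zero , x) ~ g i within G
    adj zero                   = cyclic-edge (inj₁ refl)
    adj (suc zero)             = cyclic-edge (inj₂ (next-prev x))
    adj (suc (suc zero))       = incident-edge (inj₁ refl)
    adj (suc (suc (suc zero))) = incident-edge (inj₂ (inj₁ (sym (next-prev x))))

  block-not-four : ∀ y → ¬ FourNeighbours (suc zero , y)
  block-not-four y (g , inj , adj) =
    <⇒notInjective {f = index} (s≤s (s≤s (s≤s (s≤s z≤n)))) λ {i} {j} eq →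
      inj (trans (sym (index-correct i)) (trans (cong point eq) (index-correct j)))
    where
    point : Fin 3 → Fin 2 × P
    point zero             = zero , y
    point (suc zero)       = zero , next y
    point (suc (suc zero)) = zero , next (next (next y))
    locate : ∀ v → (suc zero , y) ~ v within G → ∃ λ i → point i ≡ v
    locate (zero , x) (_ , eq) with indicator-one (incident? x y) eq
    ... | inj₁ refl        = zero , refl
    ... | inj₂ (inj₁ refl) = suc zero , refl
    ... | inj₂ (inj₂ refl) = suc (suc zero) , refl
    locate (suc zero , x) (_ , ())
    index : Fin 4 → Fin 3
    index i = proj₁ (locate (g i) (adj i))
    index-correct : ∀ i → point (index i) ≡ g i
    index-correct i = proj₂ (locate (g i) (adj i))

  -- Degrees force `σ` to act as `s` on points and `t` on blocks. On the cycle `s` keeps one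
  -- orientation; the blocks exclude the reversed one, so `s` is a translation, and incidence then
  -- forces `t` to agree with it.
  incidence-complete : ∀ σ → IsAut G σ → ∃ λ a → ∀ v → σ v ≡ diagonal p 2 a v
  incidence-complete σ aut@(_ , pres) = s zero , λ where
      (zero , x)     → trans (proj₂ (points x)) (cong (zero ,_) (translation x))
      (suc zero , y) → trans (proj₂ (blocks y)) (cong (suc zero ,_) (trans (t≗s y) (translation y)))
    where
    σ-adj : ∀ {u v} → u ~ v within G → σ u ~ σ v within G
    σ-adj = aut-adj {G = G} aut
    reflect : ∀ {u v} → σ u ~ σ v within G → u ~ v within G
    reflect (≢ , eq) = ≢ ∘ cong σ , trans (sym (pres _ _ (≢ ∘ cong σ))) eq
    four : ∀ {v} → FourNeighbours v → FourNeighbours (σ v)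
    four (g , inj , adj) = σ ∘ g , inj ∘ aut-injective {G = G} aut , σ-adj ∘ adj
    four⁻ : ∀ {v} → FourNeighbours (σ v) → FourNeighbours v
    four⁻ {v} (g , inj , adj) = h , (λ eq → inj (trans (sym (σh _)) (trans (cong σ eq) (σh _)))) ,
        λ i → reflect (subst (λ w → σ v ~ w within G) (sym (σh i)) (adj i))
      where
      h : Fin 4 → Fin 2 × P
      h i = proj₁ (aut-preimage {G = G} aut (g i))
      σh : ∀ i → σ (h i) ≡ g i
      σh i = proj₂ (aut-preimage {G = G} aut (g i))
    points : ∀ x → ∃ λ x′ → σ (zero , x) ≡ (zero , x′)
    points x with σ (zero , x) in eq
    ... | zero , x′     = x′ , refl
    ... | suc zero , y′ = ⊥-elim (block-not-four y′ (subst FourNeighbours eq (four (cycle-four x))))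
    blocks : ∀ y → ∃ λ y′ → σ (suc zero , y) ≡ (suc zero , y′)
    blocks y with σ (suc zero , y) in eq
    ... | zero , x′     = ⊥-elim (block-not-four y (four⁻ (subst FourNeighbours (sym eq) (cycle-four x′))))
    ... | suc zero , y′ = y′ , refl
    s t : P → P
    s x = proj₁ (points x)
    t y = proj₁ (blocks y)
    s-injective : ∀ {x y} → s x ≡ s y → x ≡ y
    s-injective {x} {y} eq = cong proj₂ (aut-injective {G = G} aut
      (trans (proj₂ (points x)) (trans (cong (zero ,_) eq) (sym (proj₂ (points y))))))
    s-cyclic : ∀ x → Cyclic (s x) (s (next x))
    s-cyclic x = indicator-one (cyclic? _ _)
      (proj₂ (subst₂ (λ u v → u ~ v within G) (proj₂ (points x)) (proj₂ (points (next x)))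
        (σ-adj (cyclic-edge (inj₁ refl)))))
    s-incident : ∀ {x y} → Incident x y → Incident (s x) (t y)
    s-incident {x} {y} i = indicator-one (incident? _ _)
      (proj₂ (subst₂ (λ u v → u ~ v within G) (proj₂ (points x)) (proj₂ (blocks y)) (σ-adj (incident-edge i))))

    -- An injective map cannot turn round on the cycle.
    keeps-up : ∀ x → next (s x) ≡ s (next x) → next (s (next x)) ≡ s (next (next x))
    keeps-up x up with s-cyclic (next x)
    ... | inj₁ up′  = up′
    ... | inj₂ down = ⊥-elim (nexts-≢ 2 0 x (s-injective (next-injective (trans down (sym up)))))
    keeps-down : ∀ x → next (s (next x)) ≡ s x → next (s (next (next x))) ≡ s (next x)
    keeps-down x down with s-cyclic (next x)
    ... | inj₂ down′ = down′
    ... | inj₁ up    = ⊥-elim (nexts-≢ 2 0 x (s-injective (trans (sym up) down)))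

    everywhere : (Q : P → Set) → (∀ x → Q x → Q (next x)) → Q zero → ∀ x → Q x
    everywhere Q step base x = subst Q (residue-toℕ x) (go (toℕ x))
      where
      go : ∀ m → Q (residue m)
      go zero    = base
      go (suc m) = subst Q (next-residue m) (step (residue m) (go m))

    no-reflection : ¬ (∀ x → next (s (next x)) ≡ s x)
    -- The block of zero has points 0, 1, 3, and reversal mirrors their gaps: with `z = s 3` the
    -- images are `z`, `z + 2`, `z + 3`, all to lie among `w`, `w + 1`, `w + 3` for `w = t zero`.
    -- Depending on the place of `z`, this would put `w + 2`, `w + 4` or `w + 5` into that block.
    no-reflection down = impossible _ _
        (s-incident (inj₂ (inj₂ refl)))
        (subst (λ w → Incident w (t zero)) (trans (sym (down _)) (cong next (sym (down _))))
          (s-incident (inj₂ (inj₁ refl))))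
        (subst (λ w → Incident w (t zero))
          (trans (sym (down _)) (cong next (trans (sym (down _)) (cong next (sym (down _))))))
          (s-incident (inj₁ refl)))
      where
      impossible : ∀ z w → Incident z w → Incident (next (next z)) w → Incident (next (next (next z))) w → ⊥
      impossible _ w (inj₁ refl) (inj₁ e) _ = nexts-≢ 2 0 w e
      impossible _ w (inj₁ refl) (inj₂ (inj₁ e)) _ = nexts-≢ 2 1 w e
      impossible _ w (inj₁ refl) (inj₂ (inj₂ e)) _ = nexts-≢ 2 3 w e
      impossible _ w (inj₂ (inj₁ refl)) _ (inj₁ e) = nexts-≢ 4 0 w e
      impossible _ w (inj₂ (inj₁ refl)) _ (inj₂ (inj₁ e)) = nexts-≢ 4 1 w e
      impossible _ w (inj₂ (inj₁ refl)) _ (inj₂ (inj₂ e)) = nexts-≢ 4 3 w e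
      impossible _ w (inj₂ (inj₂ refl)) (inj₁ e) _ = nexts-≢ 5 0 w e
      impossible _ w (inj₂ (inj₂ refl)) (inj₂ (inj₁ e)) _ = nexts-≢ 5 1 w e
      impossible _ w (inj₂ (inj₂ refl)) (inj₂ (inj₂ e)) _ = nexts-≢ 5 3 w e

    s-next : ∀ x → next (s x) ≡ s (next x)
    s-next with s-cyclic zero
    ... | inj₁ up   = everywhere _ keeps-up up
    ... | inj₂ down = ⊥-elim (no-reflection (everywhere _ keeps-down down))

    translation : ∀ x → s x ≡ addMod x (s zero)
    translation = commutes-next⇒translation (λ x → sym (s-next x))

    -- Block `t y` contains `s y` and its successor; among `w`, `w + 1`, `w + 3` only the first two
    -- are consecutive.
    t≗s : ∀ y → t y ≡ s y
    t≗s y = same _ _ (s-incident (inj₁ refl))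
      (subst (λ w → Incident w (t y)) (sym (s-next y)) (s-incident (inj₂ (inj₁ refl))))
      where
      same : ∀ z w → Incident z w → Incident (next z) w → w ≡ z
      same _ w (inj₁ refl) _ = refl
      same _ w (inj₂ (inj₁ refl)) (inj₁ e) = ⊥-elim (nexts-≢ 2 0 w e)
      same _ w (inj₂ (inj₁ refl)) (inj₂ (inj₁ e)) = ⊥-elim (nexts-≢ 2 1 w e)
      same _ w (inj₂ (inj₁ refl)) (inj₂ (inj₂ e)) = ⊥-elim (nexts-≢ 2 3 w e)
      same _ w (inj₂ (inj₂ refl)) (inj₁ e) = ⊥-elim (nexts-≢ 4 0 w e)
      same _ w (inj₂ (inj₂ refl)) (inj₂ (inj₁ e)) = ⊥-elim (nexts-≢ 4 1 w e)
      same _ w (inj₂ (inj₂ refl)) (inj₂ (inj₂ e)) = ⊥-elim (nexts-≢ 4 3 w e)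

  incidence-seed : Seed p 1
  incidence-seed = record
    { graph = G ; invariant = incidence-invariant ; extensible = incidence-extensible ; complete = incidence-complete }

-- Small primes: exhaustive search

module Search {k : ℕ} {V I : Set} (G : ColGraph k V) (t : I → V → V) (vertices : List V) where
  -- Colours matter for distinct vertices only, as in `IsAut`; the condition `w ≢ w′` builds
  -- injectivity into the search.
  Compatible : V → V → V × V → Set
  Compatible v w (v′ , w′) = v ≡ v′ ⊎ (w ≢ w′ × E G w w′ ≡ E G v v′)

  -- Every way of extending the partial assignment to the listed vertices, all of whose
  -- prefixes respect the colours, agrees with some member of t.
  Forced : List (V × V) → List V → Set
  Forced acc []       = ∃ λ a → All (λ (v , w) → w ≡ t a v) acc
  Forced acc (v ∷ vs) = All (λ w → All (Compatible v w) acc → Forced ((v , w) ∷ acc) vs) vertices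

  graphOf : (V → V) → List V → List (V × V)
  graphOf σ = map λ v → v , σ v

  module _ (_≟ᵥ_ : DecidableEquality V) where
    compatible-graphOf : ∀ {σ} → IsAut G σ → ∀ v vs → All (Compatible v (σ v)) (graphOf σ vs)
    compatible-graphOf aut v [] = []
    compatible-graphOf {σ} aut@(_ , pres) v (v′ ∷ vs) = compatible (v ≟ᵥ v′) ∷ compatible-graphOf aut v vs
      where
      compatible : Dec (v ≡ v′) → Compatible v (σ v) (v′ , σ v′)
      compatible (yes eq) = inj₁ eq
      compatible (no v≢v′) = inj₂ (v≢v′ ∘ aut-injective {G = G} aut , pres v v′ v≢v′)

    -- The branch that assigns `σ v` to each `v` passes every compatibility test, and its leaf names
    -- the member of `t`. Assigned vertices pile up in reverse order, hence `ʳ++`.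
    forced⇒orbit : (∀ v → v ∈ vertices) → ∀ {σ} → IsAut G σ → ∀ done todo → Forced (graphOf σ done) todo →
      ∃ λ a → ∀ {v} → v ∈ todo ʳ++ done → σ v ≡ t a v
    forced⇒orbit total {σ} aut done [] (a , eqs) = a , λ v∈ → All.lookup eqs (∈-map⁺ _ v∈)
    forced⇒orbit total {σ} aut done (v ∷ todo) forced =
      forced⇒orbit total aut (v ∷ done) todo (All.lookup forced (total (σ v)) (compatible-graphOf aut v done))

    forced⇒complete : (∀ v → v ∈ vertices) → Forced [] vertices →
      ∀ σ → IsAut G σ → ∃ λ a → ∀ v → σ v ≡ t a v
    forced⇒complete total forced σ aut with forced⇒orbit total aut [] vertices forced
    ... | a , eqs = a , λ v → eqs (reverse⁺ (total v))

module _ {k r p : ℕ} (G : ColGraph k (Fin r × Fin p)) where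
  -- All copies of one residue come before the next residue, so colours between copies are tested
  -- from the start of the search.
  vertices : List (Fin r × Fin p)
  vertices = cartesianProductWith (flip _,_) (allFin p) (allFin r)

  vertices-total : ∀ v → v ∈ vertices
  vertices-total (i , x) = ∈-cartesianProductWith⁺ (flip _,_) (∈-allFin x) (∈-allFin i)

  open Search G (diagonal p r) vertices

  _≟ᵥ_ : DecidableEquality (Fin r × Fin p)
  _≟ᵥ_ = ≡-dec _≟_ _≟_

  forced? : ∀ acc vs → Dec (Forced acc vs)
  forced? acc [] = any? λ a → All.all? (λ (v , w) → w ≟ᵥ diagonal p r a v) acc
  forced? acc (v ∷ vs) = All.all? (λ w →
    All.all? (λ (v′ , w′) → (v ≟ᵥ v′) ⊎-dec (¬? (w ≟ᵥ w′) ×-dec (E G w w′ ≟ E G v v′))) acc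
      →-dec forced? ((v , w) ∷ acc) vs) vertices

  OnlyDiagonal : Set
  OnlyDiagonal = Forced [] vertices

  onlyDiagonal? : Dec OnlyDiagonal
  onlyDiagonal? = forced? [] vertices

  onlyDiagonal⇒complete : OnlyDiagonal → ∀ σ → IsAut G σ → ∃ λ a → ∀ v → σ v ≡ diagonal p r a v
  onlyDiagonal⇒complete = forced⇒complete _≟ᵥ_ vertices-total

-- Three copies of ℤ_p with degrees p, p + 1, 2p − 1; going once round 0 – 1 – 2 – 0 advances by one.
triangleE : ∀ {n} → Fin 3 × Fin (suc n) → Fin 3 × Fin (suc n) → Fin 2
triangleE (zero , x)           (zero , y)           = zero
triangleE (suc zero , x)       (suc zero , y)       = suc zero
triangleE (suc (suc zero) , x) (suc (suc zero) , y) = suc zero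
triangleE (zero , x)           (suc zero , y)       = indicator (x ≟ y)
triangleE (suc zero , y)       (zero , x)           = indicator (x ≟ y)
triangleE (suc zero , x)       (suc (suc zero) , y) = indicator (x ≟ y)
triangleE (suc (suc zero) , y) (suc zero , x)       = indicator (x ≟ y)
triangleE (suc (suc zero) , x) (zero , y)           = indicator (¬? (next x ≟ y))
triangleE (zero , y)           (suc (suc zero) , x) = indicator (¬? (next x ≟ y))

triangle : ∀ {n} → ColGraph 2 (Fin 3 × Fin (suc n))
triangle = record { E = triangleE ; symm = λ where
  (zero , x)           (zero , y)           → refl
  (suc zero , x)       (suc zero , y)       → refl
  (suc (suc zero) , x) (suc (suc zero) , y) → refl
  (zero , x)           (suc zero , y)       → refl
  (suc zero , y)       (zero , x)           → refl
  (suc zero , x)       (suc (suc zero) , y) → refl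
  (suc (suc zero) , y) (suc zero , x)       → refl
  (suc (suc zero) , x) (zero , y)           → refl
  (zero , y)           (suc (suc zero) , x) → refl }

triangle-invariant : ∀ {n} → Invariant (triangle {n})
triangle-invariant {n} a = λ where
    (zero , x)           (zero , y)           → refl
    (suc zero , x)       (suc zero , y)       → refl
    (suc (suc zero) , x) (suc (suc zero) , y) → refl
    (zero , x)           (suc zero , y)       → match x y
    (suc zero , y)       (zero , x)           → match x y
    (suc zero , x)       (suc (suc zero) , y) → match x y
    (suc (suc zero) , y) (suc zero , x)       → match x y
    (suc (suc zero) , x) (zero , y)           → mismatch x y
    (zero , y)           (suc (suc zero) , x) → mismatch x y
  where
  match : ∀ (x y : Fin (suc n)) → indicator (addMod x a ≟ addMod y a) ≡ indicator (x ≟ y)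
  match x y = indicator-⇔ _ _ (addMod-cancelʳ a) (cong (λ w → addMod w a))
  mismatch : ∀ (x y : Fin (suc n)) →
    indicator (¬? (next (addMod x a) ≟ addMod y a)) ≡ indicator (¬? (next x ≟ y))
  mismatch x y = indicator-⇔ _ _
    (λ ≢ eq → ≢ (trans (sym (next-addMod x a)) (cong (λ w → addMod w a) eq)))
    (λ ≢ eq → ≢ (addMod-cancelʳ a (trans (next-addMod x a) eq)))

triangle-extensible : ∀ {m} → Extensible (triangle {suc m})
triangle-extensible =
    (λ x → (suc zero , x) , (λ ()) , matched x) ,
    λ { zero x → (zero , x) , (suc (suc zero) , x) , (λ ()) , ((λ ()) , matched x) , ((λ ()) , matched x)
      ; (suc zero) x → (suc zero , x) , (suc (suc zero) , next x) , (λ ()) ,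
                       ((λ ()) , matched x) , (next-≢ x ∘ cong proj₂ , refl) }
  where
  matched : ∀ {n} (x : Fin n) → indicator (x ≟ x) ≡ suc zero
  matched x = indicator-yes (x ≟ x) refl

triangle-seed : ∀ {m} → OnlyDiagonal (triangle {suc m}) → Seed (suc (suc m)) 2
triangle-seed only = record
  { graph = triangle ; invariant = triangle-invariant ; extensible = triangle-extensible
  ; complete = onlyDiagonal⇒complete triangle only }

edge : ColGraph 2 (Fin 1 × Fin 2)
edge = record { E = λ _ _ → suc zero ; symm = λ _ _ → refl }

edge-seed : Seed 2 0
edge-seed = record
  { graph = edge ; invariant = λ _ _ _ → refl
  ; extensible = (λ x → (zero , next x) , next-≢ x ∘ cong proj₂ , refl) , λ ()
  ; complete = onlyDiagonal⇒complete edge (from-yes (onlyDiagonal? edge)) }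

-- Two copies in three colours

rank : {P Q : Set} → Dec P → Dec Q → Fin 3
rank (yes _) _  = zero
rank (no _)  Q? = suc (indicator Q?)

rank-⇔ : {P Q P′ Q′ : Set} (P? : Dec P) (Q? : Dec Q) (P′? : Dec P′) (Q′? : Dec Q′) →
  (P → P′) → (P′ → P) → (Q → Q′) → (Q′ → Q) → rank P? Q? ≡ rank P′? Q′?
rank-⇔ (yes _) _ (yes _) _ _ _ _ _ = refl
rank-⇔ (yes p) _ (no ¬p) _ to _ _ _ = ⊥-elim (¬p (to p))
rank-⇔ (no ¬p) _ (yes p) _ _ from _ _ = ⊥-elim (¬p (from p))
rank-⇔ (no _) Q? (no _) Q′? _ _ to from = cong suc (indicator-⇔ Q? Q′? to from)

-- A vertex of copy zero lies on `p` edges of colour zero, one of copy one on a single such edge, so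
-- the copies cannot be exchanged. Across, colour zero identifies the copies and colour two marks
-- successors.
flagE : ∀ {n} → Fin 2 × Fin (suc n) → Fin 2 × Fin (suc n) → Fin 3
flagE (zero , x)     (zero , y)     = zero
flagE (suc zero , x) (suc zero , y) = suc zero
flagE (zero , x)     (suc zero , y) = rank (x ≟ y) (next x ≟ y)
flagE (suc zero , y) (zero , x)     = rank (x ≟ y) (next x ≟ y)

flag : ∀ {n} → ColGraph 3 (Fin 2 × Fin (suc n))
flag = record { E = flagE ; symm = λ where
  (zero , x)     (zero , y)     → refl
  (suc zero , x) (suc zero , y) → refl
  (zero , x)     (suc zero , y) → refl
  (suc zero , y) (zero , x)     → refl }

flag-invariant : ∀ {n} → Invariant (flag {n})
flag-invariant {n} a = λ where
    (zero , x)     (zero , y)     → refl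
    (suc zero , x) (suc zero , y) → refl
    (zero , x)     (suc zero , y) → cross x y
    (suc zero , y) (zero , x)     → cross x y
  where
  cross : ∀ (x y : Fin (suc n)) →
    rank (addMod x a ≟ addMod y a) (next (addMod x a) ≟ addMod y a) ≡ rank (x ≟ y) (next x ≟ y)
  cross x y = rank-⇔ _ _ _ _
    (addMod-cancelʳ a) (cong (λ w → addMod w a))
    (λ eq → addMod-cancelʳ a (trans (next-addMod x a) eq))
    (λ eq → trans (sym (next-addMod x a)) (cong (λ w → addMod w a) eq))

flag-avoids : ∀ {m} → Avoids zero (flag {suc m})
flag-avoids (zero , x)     = (suc zero , next x) , (λ ()) , nonzero (x ≟ next x)
  where
  nonzero : (x≟ : Dec (x ≡ next x)) → rank x≟ (next x ≟ next x) ≢ zero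
  nonzero (yes eq) _ = next-≢ x eq
  nonzero (no _)   ()
flag-avoids (suc zero , x) = (suc zero , next x) , next-≢ x ∘ cong proj₂ , λ ()

flag⇒InGR : ∀ {m} → OnlyDiagonal (flag {suc m}) → ∀ q → InGR 3 (CpParI (suc (suc m)) 2 q)
flag⇒InGR only = realizes-diagonal⇒InGR {G = flag} (zero , zero) flag-avoids
  (invariant⇒sound flag flag-invariant , onlyDiagonal⇒complete flag only)

-- Reflections

reflection : ∀ {n} → Fin (suc n) → Fin (suc n) → Fin (suc n)
reflection c x = addMod c (negMod x)

reflection-+ : ∀ {n} (c x : Fin (suc n)) → addMod (reflection c x) x ≡ c
reflection-+ c x = addMod-negʳ c x

reflection-unique : ∀ {n} {c x y : Fin (suc n)} → addMod y x ≡ c → y ≡ reflection c x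
reflection-unique {c = c} {x} eq = addMod-cancelʳ x (trans eq (sym (reflection-+ c x)))

reflection-involutive : ∀ {n} (c x : Fin (suc n)) → reflection c (reflection c x) ≡ x
reflection-involutive c x = sym (reflection-unique (trans (addMod-comm x (reflection c x)) (reflection-+ c x)))

-- Each copy has its own centre: with two copies, the second centre depends on the colours between
-- them.
reflections : ∀ {n r q} → (Fin r → Fin (suc n)) → Dom (suc n) r q → Dom (suc n) r q
reflections c (inj₁ (i , x)) = inj₁ (i , reflection (c i) x)
reflections c (inj₂ j)       = inj₂ j

reflections-involutive : ∀ {n r q} (c : Fin r → Fin (suc n)) (v : Dom (suc n) r q) →
  reflections c (reflections c v) ≡ v
reflections-involutive c (inj₁ (i , x)) = cong (λ w → inj₁ (i , w)) (reflection-involutive (c i) x)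
reflections-involutive c (inj₂ j)       = refl

module _ {k n r q : ℕ} (G : ColGraph k (Dom (suc n) r q)) (sound : ∀ a → IsAut G (act a)) where
  private
    V : Set
    V = Dom (suc n) r q

  -- Translation by `x + y - c` carries `c - x`, `c - y` to `y`, `x`. As edges are unordered, every
  -- circulant colouring admits all reflections.
  layer-reflection : ∀ i c x y → x ≢ y →
    E G (inj₁ (i , reflection c x)) (inj₁ (i , reflection c y)) ≡ E G (inj₁ (i , x)) (inj₁ (i , y))
  layer-reflection i c x y x≢y = begin
    E G (inj₁ (i , x*)) (inj₁ (i , y*))                         ≡⟨ proj₂ (sound a) _ _ (x*≢y* ∘ cong proj₂ ∘ inj₁-injective) ⟨
    E G (inj₁ (i , addMod x* a)) (inj₁ (i , addMod y* a))       ≡⟨ cong₂ (λ u v → E G (inj₁ (i , u)) (inj₁ (i , v))) x*+a y*+a ⟩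
    E G (inj₁ (i , y)) (inj₁ (i , x))                           ≡⟨ symm G _ _ ⟩
    E G (inj₁ (i , x)) (inj₁ (i , y))                           ∎
    where
    open ≡-Reasoning
    x* y* a : Fin (suc n)
    x* = reflection c x
    y* = reflection c y
    a = addMod y (negMod x*)
    x*≢y* : x* ≢ y*
    x*≢y* eq = x≢y (trans (sym (reflection-involutive c x)) (trans (cong (reflection c) eq) (reflection-involutive c y)))
    x*+a : addMod x* a ≡ y
    x*+a = trans (addMod-comm x* a) (addMod-negʳ y x*)
    y*+a : addMod y* a ≡ x
    y*+a = begin
      addMod y* a                              ≡⟨ addMod-assoc y* y (negMod x*) ⟨
      addMod (addMod y* y) (negMod x*)         ≡⟨ cong (λ w → addMod w (negMod x*)) (reflection-+ c y) ⟩
      reflection c x*                          ≡⟨ reflection-involutive c x ⟩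
      x                                        ∎

  -- Edges inside a copy and edges to fixed points are preserved for any centres; only the edges
  -- between different copies impose a condition.
  reflections-aut : (c : Fin r → Fin (suc n)) →
    (∀ i j x y → i ≢ j → E G (reflections c (inj₁ (i , x))) (reflections c (inj₁ (j , y)))
                         ≡ E G (inj₁ (i , x)) (inj₁ (j , y))) →
    IsAut G (reflections c)
  reflections-aut c cross = (inj , λ y → reflections c y , λ { refl → reflections-involutive c y }) , pres
    where
    inj : ∀ {x y} → reflections c x ≡ reflections c y → x ≡ y
    inj {x} {y} eq = trans (sym (reflections-involutive c x)) (trans (cong (reflections c) eq) (reflections-involutive c y))
    -- Translations are transitive on a copy and fix `j`, so all edges from the copy to `j` have the
    -- same colour.
    fixed : ∀ i x j → E G (reflections c (inj₁ (i , x))) (inj₂ j) ≡ E G (inj₁ (i , x)) (inj₂ j)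
    fixed i x j = begin
      E G (inj₁ (i , x*)) (inj₂ j)             ≡⟨ proj₂ (sound a) _ _ (λ ()) ⟨
      E G (inj₁ (i , addMod x* a)) (inj₂ j)    ≡⟨ cong (λ u → E G (inj₁ (i , u)) (inj₂ j)) (trans (addMod-comm x* a) (addMod-negʳ x x*)) ⟩
      E G (inj₁ (i , x)) (inj₂ j)              ∎
      where
      open ≡-Reasoning
      x* a : Fin (suc n)
      x* = reflection (c i) x
      a = addMod x (negMod x*)
    pres : ∀ u v → u ≢ v → E G (reflections c u) (reflections c v) ≡ E G u v
    pres (inj₁ (i , x)) (inj₁ (j , y)) u≢v with i ≟ j
    ... | yes refl = layer-reflection i (c i) x y (u≢v ∘ cong (λ w → inj₁ (i , w)))
    ... | no i≢j   = cross i j x y i≢j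
    pres (inj₁ (i , x)) (inj₂ j) _ = fixed i x j
    pres (inj₂ j) (inj₁ (i , x)) _ = trans (symm G _ _) (trans (fixed i x j) (symm G _ _))
    pres (inj₂ i) (inj₂ j) _ = refl

-- If `c - x = x + a` for all `x`, then comparing `x = 0` with `x = 1` gives `a = a + 2`, impossible
-- for a modulus above two.
reflections-≢-act : ∀ {n r q} (c : Fin (suc r) → Fin (suc n)) a → 2 < suc n →
  ¬ (∀ v → reflections {q = q} c v ≡ act a v)
reflections-≢-act {n} c a 2<p agree with nexts-injective 2 0 a 2<p z<s (begin
    next (next a)                                          ≡⟨ cong next (addMod-comm a (residue 1)) ⟩
    next (addMod (residue 1) a)                            ≡⟨ centre (residue 1) ⟩
    c zero                                                 ≡⟨ centre zero ⟨
    addMod (addMod zero a) zero                            ≡⟨ addMod-identityʳ _ ⟩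
    addMod zero a                                          ≡⟨ addMod-identityˡ a ⟩
    a                                                      ∎)
  where
  open ≡-Reasoning
  centre : ∀ x → addMod (addMod x a) x ≡ c zero
  centre x = trans (cong (λ w → addMod w x) (sym (cong proj₂ (inj₁-injective (agree (inj₁ (zero , x)))))))
    (reflection-+ (c zero) x)
... | ()

-- With a single copy there are no edges between copies, so reflecting it is an automorphism for any
-- number of colours.
one-layer∉GR : ∀ {n q} → 2 < suc n → ¬ InGRany (CpParI (suc n) 1 q)
one-layer∉GR 2<p (k , inGR) with InGR⇒realizes {t = act} inGR
... | G , sound , complete
  with complete _ (reflections-aut G sound (λ _ → zero) λ { zero zero _ _ 0≢0 → ⊥-elim (0≢0 refl) })
...   | a , agree = reflections-≢-act (λ _ → zero) a 2<p agree

ReflectionSymmetric : ℕ → Set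
ReflectionSymmetric n = ∀ (f : Fin (suc n) → Fin 2) → ∃ λ c → ∀ d → f (reflection c d) ≡ f d

-- By translation invariance the colour between `x` and `y` depends on `d = y - x` alone. Negating
-- copy zero and reflecting copy one in `c₁` turns `d` into `c₁ - d`, which `symmetric` makes
-- harmless for a suitable `c₁`.
two-layers∉GR₂ : ∀ {n q} → 2 < suc n → ReflectionSymmetric n → ¬ InGR 2 (CpParI (suc n) 2 q)
two-layers∉GR₂ {n} {q} 2<p symmetric inGR with InGR⇒realizes {t = act} inGR
... | G , sound , complete = reflections-≢-act c (proj₁ orbit) 2<p (proj₂ orbit)
  where
  open ≡-Reasoning
  difference : Fin (suc n) → Fin 2
  difference d = E G (inj₁ (zero , zero)) (inj₁ (suc zero , d))
  c₁ : Fin (suc n)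
  c₁ = proj₁ (symmetric difference)
  c : Fin 2 → Fin (suc n)
  c zero       = zero
  c (suc zero) = c₁
  E-difference : ∀ x y d → addMod d x ≡ y → E G (inj₁ (zero , x)) (inj₁ (suc zero , y)) ≡ difference d
  E-difference x y d refl = begin
    E G (inj₁ (zero , x)) (inj₁ (suc zero , addMod d x))              ≡⟨ cong (λ w → E G (inj₁ (zero , w)) (inj₁ (suc zero , addMod d x))) (addMod-identityˡ x) ⟨
    E G (inj₁ (zero , addMod zero x)) (inj₁ (suc zero , addMod d x))  ≡⟨ proj₂ (sound x) _ _ (λ ()) ⟩
    difference d                                                      ∎
  crossing : ∀ x y → E G (reflections c (inj₁ (zero , x))) (reflections c (inj₁ (suc zero , y)))
                       ≡ E G (inj₁ (zero , x)) (inj₁ (suc zero , y))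
  crossing x y = begin
    E G (inj₁ (zero , x*)) (inj₁ (suc zero , y*))     ≡⟨ E-difference x* y* (reflection c₁ d) d*+x* ⟩
    difference (reflection c₁ d)                      ≡⟨ proj₂ (symmetric difference) d ⟩
    difference d                                      ≡⟨ E-difference x y d (addMod-negʳ y x) ⟨
    E G (inj₁ (zero , x)) (inj₁ (suc zero , y))       ∎
    where
    x* y* d : Fin (suc n)
    x* = reflection zero x
    y* = reflection c₁ y
    d = addMod y (negMod x)
    x*≡-x : x* ≡ negMod x
    x*≡-x = addMod-identityˡ (negMod x)
    d*+x* : addMod (reflection c₁ d) x* ≡ y*
    d*+x* = reflection-unique (begin
      addMod (addMod (reflection c₁ d) x*) y           ≡⟨ addMod-assoc (reflection c₁ d) x* y ⟩
      addMod (reflection c₁ d) (addMod x* y)           ≡⟨ cong (addMod (reflection c₁ d)) (trans (addMod-comm x* y) (cong (addMod y) x*≡-x)) ⟩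
      addMod (reflection c₁ d) d                       ≡⟨ reflection-+ c₁ d ⟩
      c₁                                               ∎)
  cross : ∀ i j x y → i ≢ j →
    E G (reflections c (inj₁ (i , x))) (reflections c (inj₁ (j , y))) ≡ E G (inj₁ (i , x)) (inj₁ (j , y))
  cross zero       zero       x y i≢j = ⊥-elim (i≢j refl)
  cross (suc zero) (suc zero) x y i≢j = ⊥-elim (i≢j refl)
  cross zero       (suc zero) x y _   = crossing x y
  cross (suc zero) zero       x y _   = trans (symm G _ _) (trans (crossing y x) (symm G _ _))
  orbit : ∃ λ a → ∀ v → reflections c v ≡ act a v
  orbit = complete _ (reflections-aut G sound c cross)

-- Finite checks for `p = 3` and `p = 5`

allVec? : ∀ {m n} {P : Vec (Fin m) n → Set} → Decidable P → Dec (∀ v → P v)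
allVec? {n = zero} P? = map′ (λ { p [] → p }) (λ all → all []) (P? [])
allVec? {n = suc n} P? = map′ (λ { all (b ∷ v) → all b v }) (λ all b v → all (b ∷ v))
  (all? λ b → allVec? λ v → P? (b ∷ v))

-- Colourings become vectors, over which a universal statement is decided by recursion on the
-- length.
ReflectionSymmetricVec : ∀ {n} → Vec (Fin 2) (suc n) → Set
ReflectionSymmetricVec f = ∃ λ c → ∀ d → lookup f (reflection c d) ≡ lookup f d

reflectionSymmetricVec? : ∀ {n} → Dec (∀ (f : Vec (Fin 2) (suc n)) → ReflectionSymmetricVec f)
reflectionSymmetricVec? = allVec? λ f → any? λ c → all? λ d → lookup f (reflection c d) ≟ lookup f d

vec⇒reflectionSymmetric : ∀ {n} → (∀ (f : Vec (Fin 2) (suc n)) → ReflectionSymmetricVec f) → ReflectionSymmetric n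
vec⇒reflectionSymmetric sym-vec f with sym-vec (tabulate f)
... | c , eq = c , λ d → trans (sym (lookup∘tabulate f (reflection c d))) (trans (eq d) (lookup∘tabulate f d))

triangle₃-only : OnlyDiagonal (triangle {2})
triangle₃-only = from-yes (onlyDiagonal? (triangle {2}))

triangle₅-only : OnlyDiagonal (triangle {4})
triangle₅-only = from-yes (onlyDiagonal? (triangle {4}))

flag₃-only : OnlyDiagonal (flag {2})
flag₃-only = from-yes (onlyDiagonal? (flag {2}))

flag₅-only : OnlyDiagonal (flag {4})
flag₅-only = from-yes (onlyDiagonal? (flag {4}))

-- The check succeeds for 3 and 5 residues because one colour is taken at most twice, say at `a` and
-- `b` (possibly equal): the reflection with centre `a + b` preserves both classes.
reflectionSymmetric₃ : ReflectionSymmetric 2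
reflectionSymmetric₃ = vec⇒reflectionSymmetric (from-yes (reflectionSymmetricVec? {2}))

reflectionSymmetric₅ : ReflectionSymmetric 4
reflectionSymmetric₅ = vec⇒reflectionSymmetric (from-yes (reflectionSymmetricVec? {4}))

theorem3p9 : (p r q : ℕ) → Prime p → 1 ≤ r →
    ((r ≡ 1 → p ≢ 2 → ¬ InGRany (CpParI p r q))
    × (r ≡ 2 → (p ≡ 3 ⊎ p ≡ 5) → InGRstar 3 (CpParI p r q))
    × (¬ (r ≡ 1 × p ≢ 2) → ¬ (r ≡ 2 × (p ≡ 3 ⊎ p ≡ 5)) → InGR 2 (CpParI p r q)))
theorem3p9 p r q p-prime 1≤r = part₁ p r p-prime , part₂ p r , part₃ p r p-prime 1≤r
  where
  part₁ : ∀ p r → Prime p → r ≡ 1 → p ≢ 2 → ¬ InGRany (CpParI p r q)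
  part₁ 0 _ p-prime = ⊥-elim (from-no (prime? 0) p-prime)
  part₁ 1 _ p-prime = ⊥-elim (from-no (prime? 1) p-prime)
  part₁ 2 _ _ _ p≢2 = ⊥-elim (p≢2 refl)
  part₁ (suc (suc (suc n))) _ _ refl _ = one-layer∉GR (s<s (s<s z<s))

  part₂ : ∀ p r → r ≡ 2 → p ≡ 3 ⊎ p ≡ 5 → InGRstar 3 (CpParI p r q)
  part₂ _ _ refl (inj₁ refl) = flag⇒InGR flag₃-only q , two-layers∉GR₂ (s<s (s<s z<s)) reflectionSymmetric₃
  part₂ _ _ refl (inj₂ refl) = flag⇒InGR flag₅-only q , two-layers∉GR₂ (s<s (s<s z<s)) reflectionSymmetric₅

  part₃ : ∀ p r → Prime p → 1 ≤ r → ¬ (r ≡ 1 × p ≢ 2) → ¬ (r ≡ 2 × (p ≡ 3 ⊎ p ≡ 5)) → InGR 2 (CpParI p r q)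
  part₃ 0 _ p-prime = ⊥-elim (from-no (prime? 0) p-prime)
  part₃ 1 _ p-prime = ⊥-elim (from-no (prime? 1) p-prime)
  -- The base seed has index 0 here, 2 for `p = 3, 5` and 1 for `p ≥ 7`; `d` pendant copies make up
  -- the remaining number of copies.
  part₃ 2 (suc d) _ _ _ _ = seed⇒InGR (seed-+ d edge-seed) q
  part₃ (suc (suc (suc _))) 1 _ _ ¬1 _ = ⊥-elim (¬1 (refl , λ ()))
  part₃ 3 2 _ _ _ ¬2 = ⊥-elim (¬2 (refl , inj₁ refl))
  part₃ 3 (suc (suc (suc d))) _ _ _ _ = seed⇒InGR (seed-+ d (triangle-seed triangle₃-only)) q
  part₃ 4 _ p-prime = ⊥-elim (from-no (prime? 4) p-prime)
  part₃ 5 2 _ _ _ ¬2 = ⊥-elim (¬2 (refl , inj₂ refl))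
  part₃ 5 (suc (suc (suc d))) _ _ _ _ = seed⇒InGR (seed-+ d (triangle-seed triangle₅-only)) q
  part₃ 6 _ p-prime = ⊥-elim (from-no (prime? 6) p-prime)
  part₃ (suc (suc (suc (suc (suc (suc (suc n))))))) (suc (suc d)) _ _ _ _ =
    seed⇒InGR (seed-+ d (incidence-seed n)) q
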